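{- Let $n\ge 1$, $\mathbf{L}\in\{\mathbf{E},\mathbf{M},\mathbf{C},\mathbf{N}\}$, and let $\varphi$ be an $\mathit{ML}^n_{\mathcal{ALC}}$ formula (in the normal form described in the context). If, having started on the initial completion set $\mathbf{T}_\varphi=\{0:\varphi,\ 0:\top(x)\}$, the $\mathbf{L}^n_{\mathcal{ALC}}$ tableau algorithm constructs (in some run) an $\mathbf{L}^n_{\mathcal{ALC}}$-complete and clash-free completion set for $\varphi$, then $\varphi$ is $\mathbf{L}^n_{\mathcal{ALC}}$ satisfiable, i.e. $\varphi$ is satisfied in some varying domain neighbourhood model based on a frame in the class for $\mathbf{L}$.
   Context: **Syntax.** Let $\mathsf{N_C}$, $\mathsf{N_R}$ be countably infinite disjoint sets of concept names and role names, $I=\{1,\dots,n\}$. $\mathit{ML}^n_{\mathcal{ALC}}$ concepts: $C::=A\mid\neg C\mid C\sqcap C\mid\exists r.C\mid\Box_i C$ ($A\in\mathsf{N_C}$, $r\in\mathsf{N_R}$, $i\in I$). A concept inclusion (CI) is $C\sqsubseteq D$. $\mathit{ML}^n_{\mathcal{ALC}}$ formulas: $\varphi::=C\sqsubseteq D\mid\neg\varphi\mid\varphi\wedge\varphi\mid\Box_i\varphi$. Abbreviations: $\bot:=A\sqcap\neg A$, $\top:=\neg\bot$, $\forall r.C:=\neg\exists r.\neg C$, $C\sqcup D:=\neg(\neg C\sqcap\neg D)$, $\Diamond_i C:=\neg\Box_i\neg C$, and analogously $\vee,\Diamond_i$ for formulas. **Semantics.** A neighbourhood frame is $\mathcal{F}=(\mathcal{W},\{\mathcal{N}_i\}_{i\in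 I})$ with $\mathcal{W}\neq\emptyset$ a set of worlds and $\mathcal{N}_i:\mathcal{W}\to2^{2^{\mathcal{W}}}$. It is supplemented if for all $i,w$ and $\alpha,\beta\subseteq\mathcal{W}$, $\alpha\in\mathcal{N}_i(w)$ and $\alpha\subseteq\beta$ imply $\beta\in\mathcal{N}_i(w)$; closed under intersection if $\alpha,\beta\in\mathcal{N}_i(w)$ implies $\alpha\cap\beta\in\mathcal{N}_i(w)$ for all $i,w$; contains the unit if $\mathcal{W}\in\mathcal{N}_i(w)$ for all $i,w$. The class of frames for $\mathbf{L}$ is: all neighbourhood frames for $\mathbf{E}$; supplemented ones for $\mathbf{M}$; those closed under intersection for $\mathbf{C}$; those containing the unit for $\mathbf{N}$. A varying domain neighbourhood model based on $\mathcal{F}$ is $\mathcal{M}=(\mathcal{F},\mathcal{I})$ where $\mathcal{I}$ assigns to each $w\in\mathcal{W}$ an $\mathcal{ALC}$ interpretation $\mathcal{I}_w=(\Delta_w,\cdot^{\mathcal{I}_w})$ with $\Delta_w\neq\emptyset$, $A^{\mathcal{I}_w}\subseteq\Delta_w$, $r^{\mathcal{I}_w}\subseteq\Delta_w\times\Delta_w$ (the domains may differ between worlds). Concepts: $(\neg D)^{\mathcal{I}_w}=\Delta_w\setminus D^{\mathcal{I}_w}$, $(D\sqcap E)^{\mathcal{I}_w}=D^{\mathcal{I}_w}\cap E^{\mathcal{I}_w}$, $(\exists r.D)^{\mathcal{I}_w}=\{d\in\Delta_w\mid\exists e\in D^{\mathcal{I}_w}:(d,e)\in r^{\mathcal{I}_w}\}$,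 $(\Box_iD)^{\mathcal{I}_w}=\{d\in\Delta_w\mid\llbracket D\rrbracket^{\mathcal{M}}_d\in\mathcal{N}_i(w)\}$, where $\llbracket D\rrbracket^{\mathcal{M}}_d=\{v\in\mathcal{W}\mid d\in D^{\mathcal{I}_v}\}$ for $d\in\bigcup_{w}\Delta_w$. Formulas: $\mathcal{M},w\models C\sqsubseteq D$ iff $C^{\mathcal{I}_w}\subseteq D^{\mathcal{I}_w}$; Boolean connectives as usual; $\mathcal{M},w\models\Box_i\psi$ iff $\{v\mid\mathcal{M},v\models\psi\}\in\mathcal{N}_i(w)$. $\varphi$ is satisfied in $\mathcal{M}$ if $\mathcal{M},w\models\varphi$ for some $w\in\mathcal{W}$. **Normal form and closure.** For a concept or formula $\gamma$, $\dot\neg\gamma$ is the negation of $\gamma$ put in negation normal form (NNF). It is assumed without loss of generality that $\varphi$ is in NNF (negation only in front of CIs; built with $\wedge,\vee,\Box_i,\Diamond_i$), that it contains CIs only of the form $\top\sqsubseteq C$, and that every concept occurring in it is in NNF (negation only in front of concept names; built with $\sqcap,\sqcup,\exists r,\forall r,\Box_i,\Diamond_i$). Let $\mathsf{con}(\varphi)$, $\mathsf{for}(\varphi)$ be the sets of subconcepts and subformulas of $\varphi$, $\mathsf{con}_{\dot\neg}(\varphi)=\mathsf{con}(\varphi)\cup\{\dot\neg C\mid C\in\mathsf{con}(\varphi)\}$, $\mathsf{for}_{\dot\neg}(\varphi)=\mathsf{for}(\varphi)\cup\{\dot\neg\psi\mid\psi\in\mathsf{for}(\varphi)\}$, and $\mathsf{rol}(\varphi)$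 the set of role names occurring in $\varphi$. By the assumption on CIs, $\top\in\mathsf{con}_{\dot\neg}(\varphi)$. **Constraints.** Let $\mathsf{N_V}$ be a countable set of variables well-ordered by $<$, and $\mathsf{N_L}$ a countable set of labels (with $0\in\mathsf{N_L}$). For $\lambda\in\mathsf{N_L}$, a $\lambda$-labelled constraint for $\varphi$ is of the form $\lambda:\psi$, $\lambda:C(x)$ or $\lambda:r(x,y)$ with $\psi\in\mathsf{for}_{\dot\neg}(\varphi)$, $C\in\mathsf{con}_{\dot\neg}(\varphi)$, $r\in\mathsf{rol}(\varphi)$, $x,y\in\mathsf{N_V}$. A $\lambda$-labelled constraint system $S_\lambda$ is a set of $\lambda$-labelled constraints. A completion set $\mathbf{T}$ is a non-empty union of labelled constraint systems for $\varphi$; $S_\lambda$ denotes the system of $\lambda$-labelled constraints in $\mathbf{T}$. A variable $x$ occurs in $S_\lambda$ if $S_\lambda$ contains a constraint $\lambda:C(x)$, $\lambda:r(x,y)$ or $\lambda:r(y,x)$; $x$ is fresh for $S_\lambda$ if it does not occur in $S_\lambda$ and $x>y$ for every $y$ occurring in $S_\lambda$. Whenever $x$ occurs in $S_\lambda$, it is assumed that $\lambda:\top(x)\in S_\lambda$. A label is fresh for $\mathbf{T}$ if it does not occur in $\mathbf{T}$. For variables $x,y$ in $S_\lambda$, $x$ is blocked by $y$ in $S_\lambda$ if $x>y$ and $\{C\mid\lambda:C(x)\in S_\lambda\}\subseteq\{C\mid\lambda:C(y)\in S_\lambda\}$. $\mathbf{T}$ contains a clash if $\{\mu:\psi,\mu:\neg\psi\}\subseteq\mathbf{T}$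 or $\{\mu:C(x),\mu:\neg C(x)\}\subseteq\mathbf{T}$ for some label $\mu$, formula $\psi$ or concept $C$; otherwise it is clash-free. **$\mathbf{L}^n_{\mathcal{ALC}}$-rules.** A rule is applicable to $\mathbf{T}$ if its premises are in $\mathbf{T}$ and its application condition (in brackets) holds; applying it adds its conclusion (one nondeterministically chosen alternative, for branching rules) to $\mathbf{T}$. - $(\mathsf{R}_\wedge)$ from $\lambda:\psi\wedge\chi$ add $\lambda:\psi$ and $\lambda:\chi$ [$\{\lambda:\psi,\lambda:\chi\}\not\subseteq\mathbf{T}$]. - $(\mathsf{R}_\vee)$ from $\lambda:\psi\vee\chi$ add $\lambda:\psi$ or add $\lambda:\chi$ [$\{\lambda:\psi,\lambda:\chi\}\cap\mathbf{T}=\emptyset$]. - $(\mathsf{R}_\sqcap)$ from $\lambda:(C\sqcap D)(x)$ add $\lambda:C(x)$ and $\lambda:D(x)$ [$\{\lambda:C(x),\lambda:D(x)\}\not\subseteq\mathbf{T}$]. - $(\mathsf{R}_\sqcup)$ from $\lambda:(C\sqcup D)(x)$ add $\lambda:C(x)$ or add $\lambda:D(x)$ [$\{\lambda:C(x),\lambda:D(x)\}\cap\mathbf{T}=\emptyset$]. - $(\mathsf{R}_\exists)$ from $\lambda:\exists r.C(x)$ add $\lambda:r(x,y)$ and $\lambda:C(y)$ [$x$ is not blocked by any variable in $S_\lambda$, there is no $z$ with $\{\lambda:r(x,z),\lambda:C(z)\}\subseteq\mathbf{T}$, and $y$ is the $<$-minimal variable fresh for $S_\lambda$]. - $(\mathsf{R}_\forall)$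 from $\lambda:\forall r.C(x)$ and $\lambda:r(x,y)$ add $\lambda:C(y)$ [$\lambda:C(y)\notin\mathbf{T}$]. - $(\mathsf{R}_=)$ from $\lambda:\top\sqsubseteq C$ add $\lambda:C(x)$ [$x$ occurs in a $\lambda$-labelled constraint in $\mathbf{T}$ and $\lambda:C(x)\notin\mathbf{T}$]. - $(\mathsf{R}_{\neq})$ from $\lambda:\neg(\top\sqsubseteq C)$ add $\lambda:\dot\neg C(x)$ [$x$ is the $<$-minimal variable fresh for $S_\lambda$ and there is no $y$ with $\lambda:\dot\neg C(y)\in\mathbf{T}$]. - $(\mathsf{R}_{\mathbf{L}})$ from $\lambda:\Box_i\gamma_1,\dots,\lambda:\Box_i\gamma_k,\lambda:\Diamond_i\delta$ choose one of: (0) add $\mu:\gamma_1,\dots,\mu:\gamma_k,\mu:\delta$; or ($j$), for some $1\le j\le l$, add $\mu:\dot\neg\gamma_j,\mu:\dot\neg\delta$ [$\mu$ is a label fresh for $\mathbf{T}$, and there is no label $\nu$ with $\{\nu:\gamma_1,\dots,\nu:\gamma_k,\nu:\delta\}\subseteq\mathbf{T}$ or with $\{\nu:\dot\neg\gamma_j,\nu:\dot\neg\delta\}\subseteq\mathbf{T}$ for some $1\le j\le l$]. Here each of $\gamma_1,\dots,\gamma_k,\delta$ is either a formula in $\mathsf{for}_{\dot\neg}(\varphi)$ or an expression $C(x)$ with $C\in\mathsf{con}_{\dot\neg}(\varphi)$ (modal operators and $\dot\neg$ then act on $C$). The parameters are: $k=l=1$ for $\mathbf{L}=\mathbf{E}$;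 $k=1,l=0$ for $\mathbf{L}=\mathbf{M}$; any $k\ge1$ and $l=k$ for $\mathbf{L}=\mathbf{C}$; $k=l=1$ or $k=l=0$ for $\mathbf{L}=\mathbf{N}$. $\mathbf{T}$ is $\mathbf{L}^n_{\mathcal{ALC}}$-complete if no $\mathbf{L}^n_{\mathcal{ALC}}$-rule is applicable to it. **Algorithm.** The (nondeterministic) $\mathbf{L}^n_{\mathcal{ALC}}$ tableau algorithm for $\varphi$ starts with the initial completion set $\mathbf{T}_\varphi=\{0:\varphi,0:\top(x)\}$ and expands it by means of the $\mathbf{L}^n_{\mathcal{ALC}}$-rules until a clash or an $\mathbf{L}^n_{\mathcal{ALC}}$-complete completion set is obtained.
   Formalization: The rules gain one: a label that carries a formula but no variable gets ⊤(x) for a minimal fresh x. As stated the claim fails, since □ᵢ(⊤⊑⊤)∧◇ᵢ(⊤⊑A⊓¬A) is unsatisfiable yet has a complete clash-free completion set. -}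

module Defs where

open import Data.Fin.Base using (Fin)
open import Data.List.Base using (List; []; _∷_; _++_; [_]; map; concatMap; filter; length; take)
open import Data.List.Membership.Propositional using (_∈_; _∉_)
open import Data.List.Relation.Unary.All using (All)
open import Data.List.Relation.Unary.Any using (Any)
open import Data.Nat.Base using (ℕ; suc; _≤_; _<_)
open import Data.Nat.Properties using (_≟_)
open import Data.Product.Base using (Σ; ∃; _×_; _,_)
open import Data.Unit.Base using (⊤)
open import Level using (0ℓ; Lift)
open import Relation.Binary.Construct.Closure.ReflexiveTransitive using (Star)
open import Relation.Binary.PropositionalEquality using (_≡_; _≢_)
open import Relation.Nullary.Negation using (¬_)
open import Relation.Unary using (Pred; _≐_; _⊆_; _∩_; U)

variable
  n : ℕ

ConceptName RoleName : Set
ConceptName = ℕ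
RoleName    = ℕ

infix  9 ¬ᶜ_ ¬ᶠ_
infixr 7 _⊓ᶜ_ _∧ᶠ_
infixr 6 _⊔ᶜ_ _∨ᶠ_
infix  5 _⊑_

data Concept (n : ℕ) : Set where
  atom : ConceptName → Concept n
  ¬ᶜ_  : Concept n → Concept n
  _⊓ᶜ_ : Concept n → Concept n → Concept n
  ∃ᶜ   : RoleName → Concept n → Concept n
  □ᶜ   : Fin n → Concept n → Concept n

data Formula (n : ℕ) : Set where
  _⊑_  : Concept n → Concept n → Formula n
  ¬ᶠ_  : Formula n → Formula n
  _∧ᶠ_ : Formula n → Formula n → Formula n
  □ᶠ   : Fin n → Formula n → Formula n

-- ⊥ := A ⊓ ¬ A needs a choice of A.
A₀ : ConceptName
A₀ = 0

⊥ᶜ ⊤ᶜ : Concept n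
⊥ᶜ = atom A₀ ⊓ᶜ ¬ᶜ atom A₀
⊤ᶜ = ¬ᶜ ⊥ᶜ

_⊔ᶜ_ : Concept n → Concept n → Concept n
C ⊔ᶜ D = ¬ᶜ (¬ᶜ C ⊓ᶜ ¬ᶜ D)

∀ᶜ : RoleName → Concept n → Concept n
∀ᶜ r C = ¬ᶜ ∃ᶜ r (¬ᶜ C)

◇ᶜ : Fin n → Concept n → Concept n
◇ᶜ i C = ¬ᶜ □ᶜ i (¬ᶜ C)

_∨ᶠ_ : Formula n → Formula n → Formula n
φ ∨ᶠ ψ = ¬ᶠ (¬ᶠ φ ∧ᶠ ¬ᶠ ψ)

◇ᶠ : Fin n → Formula n → Formula n
◇ᶠ i φ = ¬ᶠ □ᶠ i (¬ᶠ φ)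

-- Subsets are predicates, so a neighbourhood function has to respect
-- extensional equality in order to be a map into sets of subsets.
record Frame (n : ℕ) : Set₁ where
  field
    W        : Set
    nonempty : W
    𝒩        : Fin n → W → Pred (Pred W 0ℓ) 0ℓ
    𝒩-resp-≐ : ∀ i w {α β} → α ≐ β → 𝒩 i w α → 𝒩 i w β

module _ (F : Frame n) where
  open Frame F

  Supplemented : Set₁
  Supplemented = ∀ i w {α β} → α ⊆ β → 𝒩 i w α → 𝒩 i w β

  ClosedUnderIntersection : Set₁
  ClosedUnderIntersection = ∀ i w {α β} → 𝒩 i w α → 𝒩 i w β → 𝒩 i w (α ∩ β)

  ContainsUnit : Set
  ContainsUnit = ∀ i w → 𝒩 i w U

data Logic : Set where
  𝐄 𝐌 𝐂 𝐍 : Logic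

FrameFor : Logic → Frame n → Set₁
FrameFor 𝐄 F = Lift _ ⊤
FrameFor 𝐌 F = Supplemented F
FrameFor 𝐂 F = ClosedUnderIntersection F
FrameFor 𝐍 F = Lift _ (ContainsUnit F)

-- The domains Δ w are subsets of one carrier, so that an object can belong
-- to the domains of several worlds.
record Model (F : Frame n) : Set₁ where
  open Frame F
  field
    Object     : Set
    Δ          : W → Pred Object 0ℓ
    Δ-nonempty : ∀ w → ∃ (Δ w)
    conceptᴵ   : W → ConceptName → Pred Object 0ℓ
    conceptᴵ⊆Δ : ∀ w A {d} → conceptᴵ w A d → Δ w d
    roleᴵ      : W → RoleName → Object → Object → Set
    roleᴵ⊆Δ    : ∀ w r {d e} → roleᴵ w r d e → Δ w d × Δ w e

module _ {F : Frame n} (M : Model F) where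
  open Frame F
  open Model M

  ext : Concept n → W → Pred Object 0ℓ
  ext (atom A) w d = conceptᴵ w A d
  ext (¬ᶜ C)   w d = Δ w d × ¬ ext C w d
  ext (C ⊓ᶜ D) w d = ext C w d × ext D w d
  ext (∃ᶜ r C) w d = Δ w d × ∃ λ e → ext C w e × roleᴵ w r d e
  ext (□ᶜ i C) w d = Δ w d × 𝒩 i w (λ v → ext C v d)

  infix 4 _⊨_

  _⊨_ : W → Formula n → Set
  w ⊨ C ⊑ D  = ∀ d → ext C w d → ext D w d
  w ⊨ ¬ᶠ φ   = ¬ w ⊨ φ
  w ⊨ φ ∧ᶠ ψ = w ⊨ φ × w ⊨ ψ
  w ⊨ □ᶠ i φ = 𝒩 i w (λ v → v ⊨ φ)

SatisfiedIn : {F : Frame n} → Model F → Formula n → Set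
SatisfiedIn M φ = ∃ λ w → _⊨_ M w φ

Satisfiable : Logic → Formula n → Set₁
Satisfiable {n} L φ =
  Σ (Frame n) λ F → FrameFor L F × Σ (Model F) λ M → SatisfiedIn M φ

infixr 7 _⊓_ _∧_
infixr 6 _⊔_ _∨_
infix  8 ⊤⊑_ ¬⊤⊑_

data NConcept (n : ℕ) : Set where
  pos neg : ConceptName → NConcept n
  _⊓_ _⊔_ : NConcept n → NConcept n → NConcept n
  ∃ⁿ ∀ⁿ   : RoleName → NConcept n → NConcept n
  □ ◇     : Fin n → NConcept n → NConcept n

-- ¬⊤⊑ C is the negated inclusion ¬ (⊤ ⊑ C).
data NFormula (n : ℕ) : Set where
  ⊤⊑_ ¬⊤⊑_ : NConcept n → NFormula n
  _∧_ _∨_  : NFormula n → NFormula n → NFormula n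
  □ ◇      : Fin n → NFormula n → NFormula n

⌊_⌋ᶜ : NConcept n → Concept n
⌊ pos A ⌋ᶜ  = atom A
⌊ neg A ⌋ᶜ  = ¬ᶜ atom A
⌊ C ⊓ D ⌋ᶜ  = ⌊ C ⌋ᶜ ⊓ᶜ ⌊ D ⌋ᶜ
⌊ C ⊔ D ⌋ᶜ  = ⌊ C ⌋ᶜ ⊔ᶜ ⌊ D ⌋ᶜ
⌊ ∃ⁿ r C ⌋ᶜ = ∃ᶜ r ⌊ C ⌋ᶜ
⌊ ∀ⁿ r C ⌋ᶜ = ∀ᶜ r ⌊ C ⌋ᶜ
⌊ □ i C ⌋ᶜ  = □ᶜ i ⌊ C ⌋ᶜ
⌊ ◇ i C ⌋ᶜ  = ◇ᶜ i ⌊ C ⌋ᶜ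

⌊_⌋ : NFormula n → Formula n
⌊ ⊤⊑ C ⌋  = ⊤ᶜ ⊑ ⌊ C ⌋ᶜ
⌊ ¬⊤⊑ C ⌋ = ¬ᶠ (⊤ᶜ ⊑ ⌊ C ⌋ᶜ)
⌊ φ ∧ ψ ⌋ = ⌊ φ ⌋ ∧ᶠ ⌊ ψ ⌋
⌊ φ ∨ ψ ⌋ = ⌊ φ ⌋ ∨ᶠ ⌊ ψ ⌋
⌊ □ i φ ⌋ = □ᶠ i ⌊ φ ⌋
⌊ ◇ i φ ⌋ = ◇ᶠ i ⌊ φ ⌋

¬̇ᶜ : NConcept n → NConcept n
¬̇ᶜ (pos A)  = neg A
¬̇ᶜ (neg A)  = pos A
¬̇ᶜ (C ⊓ D)  = ¬̇ᶜ C ⊔ ¬̇ᶜ D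
¬̇ᶜ (C ⊔ D)  = ¬̇ᶜ C ⊓ ¬̇ᶜ D
¬̇ᶜ (∃ⁿ r C) = ∀ⁿ r (¬̇ᶜ C)
¬̇ᶜ (∀ⁿ r C) = ∃ⁿ r (¬̇ᶜ C)
¬̇ᶜ (□ i C)  = ◇ i (¬̇ᶜ C)
¬̇ᶜ (◇ i C)  = □ i (¬̇ᶜ C)

¬̇ᶠ : NFormula n → NFormula n
¬̇ᶠ (⊤⊑ C)  = ¬⊤⊑ C
¬̇ᶠ (¬⊤⊑ C) = ⊤⊑ C
¬̇ᶠ (φ ∧ ψ) = ¬̇ᶠ φ ∨ ¬̇ᶠ ψ
¬̇ᶠ (φ ∨ ψ) = ¬̇ᶠ φ ∧ ¬̇ᶠ ψ
¬̇ᶠ (□ i φ) = ◇ i (¬̇ᶠ φ)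
¬̇ᶠ (◇ i φ) = □ i (¬̇ᶠ φ)

⊥ⁿ ⊤ⁿ : NConcept n
⊥ⁿ = pos A₀ ⊓ neg A₀
⊤ⁿ = ¬̇ᶜ ⊥ⁿ

subᶜ : NConcept n → List (NConcept n)
subᶜ C@(pos A)  = C ∷ []
subᶜ C@(neg A)  = C ∷ pos A ∷ []
subᶜ C@(D ⊓ E)  = C ∷ subᶜ D ++ subᶜ E
subᶜ C@(D ⊔ E)  = C ∷ subᶜ D ++ subᶜ E
subᶜ C@(∃ⁿ r D) = C ∷ subᶜ D
subᶜ C@(∀ⁿ r D) = C ∷ subᶜ D
subᶜ C@(□ i D)  = C ∷ subᶜ D
subᶜ C@(◇ i D)  = C ∷ subᶜ D

con : NFormula n → List (NConcept n)
con (⊤⊑ C)  = subᶜ ⊤ⁿ ++ subᶜ C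
con (¬⊤⊑ C) = subᶜ ⊤ⁿ ++ subᶜ C
con (φ ∧ ψ) = con φ ++ con ψ
con (φ ∨ ψ) = con φ ++ con ψ
con (□ i φ) = con φ
con (◇ i φ) = con φ

for : NFormula n → List (NFormula n)
for φ@(⊤⊑ C)  = φ ∷ []
for φ@(¬⊤⊑ C) = φ ∷ ⊤⊑ C ∷ []
for φ@(ψ ∧ χ) = φ ∷ for ψ ++ for χ
for φ@(ψ ∨ χ) = φ ∷ for ψ ++ for χ
for φ@(□ i ψ) = φ ∷ for ψ
for φ@(◇ i ψ) = φ ∷ for ψ

rolᶜ : NConcept n → List RoleName
rolᶜ (pos A)  = []
rolᶜ (neg A)  = []
rolᶜ (C ⊓ D)  = rolᶜ C ++ rolᶜ D
rolᶜ (C ⊔ D)  = rolᶜ C ++ rolᶜ D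
rolᶜ (∃ⁿ r C) = r ∷ rolᶜ C
rolᶜ (∀ⁿ r C) = r ∷ rolᶜ C
rolᶜ (□ i C)  = rolᶜ C
rolᶜ (◇ i C)  = rolᶜ C

rol : NFormula n → List RoleName
rol (⊤⊑ C)  = rolᶜ C
rol (¬⊤⊑ C) = rolᶜ C
rol (φ ∧ ψ) = rol φ ++ rol ψ
rol (φ ∨ ψ) = rol φ ++ rol ψ
rol (□ i φ) = rol φ
rol (◇ i φ) = rol φ

con¬̇ : NFormula n → List (NConcept n)
con¬̇ φ = con φ ++ map ¬̇ᶜ (con φ)

for¬̇ : NFormula n → List (NFormula n)
for¬̇ φ = for φ ++ map ¬̇ᶠ (for φ)

Var Label : Set
Var   = ℕ
Label = ℕ

infix 6 _⟨_⟩
infix 5 _∶_ _∶_⟪_∙_⟫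

-- The expressions γ, δ of the modal rule: a formula ψ, or C(x).
data Expr (n : ℕ) : Set where
  fml  : NFormula n → Expr n
  _⟨_⟩ : NConcept n → Var → Expr n

□ᴱ ◇ᴱ : Fin n → Expr n → Expr n
□ᴱ i (fml ψ)   = fml (□ i ψ)
□ᴱ i (C ⟨ x ⟩) = □ i C ⟨ x ⟩
◇ᴱ i (fml ψ)   = fml (◇ i ψ)
◇ᴱ i (C ⟨ x ⟩) = ◇ i C ⟨ x ⟩

¬̇ᴱ : Expr n → Expr n
¬̇ᴱ (fml ψ)   = fml (¬̇ᶠ ψ)
¬̇ᴱ (C ⟨ x ⟩) = ¬̇ᶜ C ⟨ x ⟩

data Constraint (n : ℕ) : Set where
  _∶_      : Label → Expr n → Constraint n
  _∶_⟪_∙_⟫ : Label → RoleName → Var → Var → Constraint n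

label : Constraint n → Label
label (ℓ ∶ _)           = ℓ
label (ℓ ∶ _ ⟪ _ ∙ _ ⟫) = ℓ

varsOf : Constraint n → List Var
varsOf (_ ∶ fml _)         = []
varsOf (_ ∶ _ ⟨ x ⟩)       = x ∷ []
varsOf (_ ∶ _ ⟪ x ∙ y ⟫) = x ∷ y ∷ []

-- Finite sets of constraints, represented by lists; only membership matters.
Constraints : ℕ → Set
Constraints n = List (Constraint n)

𝑆 : Label → Constraints n → Constraints n
𝑆 ℓ T = filter (λ c → label c ≟ ℓ) T

vars : Constraints n → List Var
vars = concatMap varsOf

ConstraintFor : NFormula n → Constraint n → Set
ConstraintFor φ (_ ∶ fml ψ)       = ψ ∈ for¬̇ φ
ConstraintFor φ (_ ∶ C ⟨ _ ⟩)     = C ∈ con¬̇ φ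
ConstraintFor φ (_ ∶ r ⟪ _ ∙ _ ⟫) = r ∈ rol φ

record CompletionSetFor (φ : NFormula n) (T : Constraints n) : Set where
  field
    nonempty    : T ≢ []
    constraints : All (ConstraintFor φ) T
    tops        : ∀ {ℓ x} → x ∈ vars (𝑆 ℓ T) → (ℓ ∶ ⊤ⁿ ⟨ x ⟩) ∈ T

FreshVar : Var → Constraints n → Set
FreshVar x S = x ∉ vars S × (∀ {y} → y ∈ vars S → y < x)

MinFreshVar : Var → Constraints n → Set
MinFreshVar x S = FreshVar x S × (∀ {y} → FreshVar y S → x ≤ y)

FreshLabel : Label → Constraints n → Set
FreshLabel μ T = ∀ {c} → c ∈ T → label c ≢ μ

BlockedBy : Label → Constraints n → Var → Var → Set
BlockedBy ℓ T x y =
  x ∈ vars (𝑆 ℓ T) × y ∈ vars (𝑆 ℓ T) × y < x ×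
  (∀ {C} → (ℓ ∶ C ⟨ x ⟩) ∈ T → (ℓ ∶ C ⟨ y ⟩) ∈ T)

-- In negation normal form, ¬ ψ and ¬ C exist only for ψ a CI and C a name.
data Clash (T : Constraints n) : Set where
  formulaClash : ∀ {μ C} →
    (μ ∶ fml (⊤⊑ C)) ∈ T → (μ ∶ fml (¬⊤⊑ C)) ∈ T → Clash T
  conceptClash : ∀ {μ A x} →
    (μ ∶ pos A ⟨ x ⟩) ∈ T → (μ ∶ neg A ⟨ x ⟩) ∈ T → Clash T

ClashFree : Constraints n → Set
ClashFree T = ¬ Clash T

-- Params L k l: the modal rule of L may be used with k boxes and the
-- additional alternatives 1, …, l.
data Params : Logic → ℕ → ℕ → Set where
  E₁₁ : Params 𝐄 1 1
  M₁₀ : Params 𝐌 1 0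
  Cₖₖ : ∀ {k} → Params 𝐂 (suc k) (suc k)
  N₁₁ : Params 𝐍 1 1
  N₀₀ : Params 𝐍 0 0

-- Applicable L T alts: some rule is applicable to T, and its alternative
-- conclusions are alts.  In R-modal the γs and δ automatically stay in the
-- closure of φ, since the closure contains their boxes and diamonds.
--
-- R-nonempty is an addition to the usual rules.  It makes Δ_w ≠ ∅ hold for
-- labels that R-modal creates from formulas alone, where no other rule need
-- introduce a variable.  Without it the unsatisfiable formula
-- □ᵢ (⊤ ⊑ ⊤) ∧ ◇ᵢ (⊤ ⊑ ⊥) would have a complete and clash-free completion
-- set, whose second label carries just ⊤ ⊑ ⊤ and ⊤ ⊑ ⊥.
data Applicable (L : Logic) (T : Constraints n) : List (Constraints n) → Set where

  R-∧ : ∀ {ℓ ψ χ} →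
    (ℓ ∶ fml (ψ ∧ χ)) ∈ T →
    ¬ ((ℓ ∶ fml ψ) ∈ T × (ℓ ∶ fml χ) ∈ T) →
    Applicable L T [ (ℓ ∶ fml ψ) ∷ (ℓ ∶ fml χ) ∷ [] ]

  R-∨ : ∀ {ℓ ψ χ} →
    (ℓ ∶ fml (ψ ∨ χ)) ∈ T →
    (ℓ ∶ fml ψ) ∉ T → (ℓ ∶ fml χ) ∉ T →
    Applicable L T ([ ℓ ∶ fml ψ ] ∷ [ ℓ ∶ fml χ ] ∷ [])

  R-⊓ : ∀ {ℓ C D x} →
    (ℓ ∶ (C ⊓ D) ⟨ x ⟩) ∈ T →
    ¬ ((ℓ ∶ C ⟨ x ⟩) ∈ T × (ℓ ∶ D ⟨ x ⟩) ∈ T) →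
    Applicable L T [ (ℓ ∶ C ⟨ x ⟩) ∷ (ℓ ∶ D ⟨ x ⟩) ∷ [] ]

  R-⊔ : ∀ {ℓ C D x} →
    (ℓ ∶ (C ⊔ D) ⟨ x ⟩) ∈ T →
    (ℓ ∶ C ⟨ x ⟩) ∉ T → (ℓ ∶ D ⟨ x ⟩) ∉ T →
    Applicable L T ([ ℓ ∶ C ⟨ x ⟩ ] ∷ [ ℓ ∶ D ⟨ x ⟩ ] ∷ [])

  R-∃ : ∀ {ℓ r C x y} →
    (ℓ ∶ ∃ⁿ r C ⟨ x ⟩) ∈ T →
    (∀ z → ¬ BlockedBy ℓ T x z) →
    (∀ z → ¬ ((ℓ ∶ r ⟪ x ∙ z ⟫) ∈ T × (ℓ ∶ C ⟨ z ⟩) ∈ T)) →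
    MinFreshVar y (𝑆 ℓ T) →
    Applicable L T [ (ℓ ∶ r ⟪ x ∙ y ⟫) ∷ (ℓ ∶ C ⟨ y ⟩) ∷ [] ]

  R-∀ : ∀ {ℓ r C x y} →
    (ℓ ∶ ∀ⁿ r C ⟨ x ⟩) ∈ T → (ℓ ∶ r ⟪ x ∙ y ⟫) ∈ T →
    (ℓ ∶ C ⟨ y ⟩) ∉ T →
    Applicable L T [ [ ℓ ∶ C ⟨ y ⟩ ] ]

  R-= : ∀ {ℓ C x} →
    (ℓ ∶ fml (⊤⊑ C)) ∈ T →
    x ∈ vars (𝑆 ℓ T) →
    (ℓ ∶ C ⟨ x ⟩) ∉ T →
    Applicable L T [ [ ℓ ∶ C ⟨ x ⟩ ] ]

  R-≠ : ∀ {ℓ C x} →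
    (ℓ ∶ fml (¬⊤⊑ C)) ∈ T →
    MinFreshVar x (𝑆 ℓ T) →
    (∀ y → (ℓ ∶ ¬̇ᶜ C ⟨ y ⟩) ∉ T) →
    Applicable L T [ [ ℓ ∶ ¬̇ᶜ C ⟨ x ⟩ ] ]

  R-modal : ∀ {k l ℓ μ} {i : Fin n} {γs δ} →
    Params L k l → length γs ≡ k →
    All (λ γ → (ℓ ∶ □ᴱ i γ) ∈ T) γs → (ℓ ∶ ◇ᴱ i δ) ∈ T →
    FreshLabel μ T →
    (∀ ν → ¬ (All (λ γ → (ν ∶ γ) ∈ T) γs × (ν ∶ δ) ∈ T)) →
    (∀ ν → ¬ Any (λ γ → (ν ∶ ¬̇ᴱ γ) ∈ T × (ν ∶ ¬̇ᴱ δ) ∈ T) (take l γs)) →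
    Applicable L T
      (map (μ ∶_) (γs ++ [ δ ])
        ∷ map (λ γ → (μ ∶ ¬̇ᴱ γ) ∷ (μ ∶ ¬̇ᴱ δ) ∷ []) (take l γs))

  R-nonempty : ∀ {ℓ ψ x} →
    (ℓ ∶ fml ψ) ∈ T →
    vars (𝑆 ℓ T) ≡ [] →
    MinFreshVar x (𝑆 ℓ T) →
    Applicable L T [ [ ℓ ∶ ⊤ⁿ ⟨ x ⟩ ] ]

Complete : Logic → Constraints n → Set
Complete L T = ∀ alts → ¬ Applicable L T alts

-- The constraints ℓ : ⊤(x) that must accompany every x occurring in S_ℓ.
topsFor : Constraints n → Constraints n
topsFor = concatMap (λ c → map (λ x → label c ∶ ⊤ⁿ ⟨ x ⟩) (varsOf c))

data Step (L : Logic) (T : Constraints n) : Constraints n → Set where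
  step : ∀ {alts concl} →
    ClashFree T → Applicable L T alts → concl ∈ alts →
    Step L T (concl ++ topsFor concl ++ T)

initial : NFormula n → Var → Constraints n
initial φ x = (0 ∶ fml φ) ∷ (0 ∶ ⊤ⁿ ⟨ x ⟩) ∷ []

Constructs : Logic → NFormula n → Var → Constraints n → Set
Constructs L φ x T = Star (Step L) (initial φ x) T

{-# OPTIONS --safe #-}

-- The worlds of the model are the labels of T, the domain of a world consists of
-- the variables occurring in its constraint system, and a blocked variable has
-- in addition the role successors of its blockers.  A label v gets as
-- i-neighbourhoods the sets α for which some premises γ₁, …, γₖ of the modal
-- rule, with v : □ᵢ γⱼ in T, satisfy
--   ⋂ⱼ {u | u : γⱼ in T} ⊆ α   and   α ⊆ {u | u : ¬̇ γⱼ not in T} for j ≤ l.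
-- This depends on T only, and all four frame conditions come from the admissible
-- pairs (k, l).  Completeness with respect to the modal rule is exactly what
-- refutes □ᵢ ¬δ when v : ◇ᵢ δ is in T.  Classically, truth of the constraints in
-- T suffices, but here it has to be proved together with the refutation of γ by
-- each constraint ¬̇ γ in T.
module Submission where

open import Defs
open import Data.Empty using (⊥-elim)
open import Data.Fin.Base using (Fin)
import Data.Fin.Properties as Fin
open import Data.List.Base using (List; []; _∷_; _++_; [_]; foldr; length; map; take)
open import Data.List.Membership.Propositional using (_∈_; _∉_; lose)
open import Data.List.Membership.Propositional.Properties
  using (∈-concatMap⁺; ∈-filter⁺; ∈-map⁺; ∈-map⁻; ∈-++⁺ʳ)
import Data.List.Membership.DecPropositional as DecMembership
open import Data.List.Properties using (length-++; take-all)
open import Data.List.Relation.Unary.All as All using (All; []; _∷_; all?)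
open import Data.List.Relation.Unary.All.Properties as All using (All¬⇒¬Any)
open import Data.List.Relation.Unary.Any as Any using (Any; here; there; any?; satisfied)
open import Data.Nat.Base using (ℕ; suc; _+_; _<_; _≤_; _≥_; z≤n) renaming (_⊔_ to _⊔ℕ_)
open import Data.Nat.Induction using (<-wellFounded)
open import Data.Nat.Properties
  using (_≟_; _<?_; <-irrefl; <-≤-trans; <-trans; m≤m⊔n; m≤n⊔m; ⊔-lub; ≤-reflexive)
open import Data.Product.Base using (∃; _×_; _,_; proj₁; proj₂)
open import Data.Sum.Base using (_⊎_; inj₁; inj₂)
open import Data.Unit.Base using (tt)
open import Function.Base using (_∘_)
open import Induction.WellFounded using (Acc; acc)
open import Level using (0ℓ; lift)
open import Relation.Binary.Construct.Closure.ReflexiveTransitive using (Star; ε; _◅_)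
open import Relation.Binary.Definitions using (DecidableEquality)
open import Relation.Binary.PropositionalEquality
  using (_≡_; refl; trans; cong; cong₂; subst)
open import Relation.Nullary.Decidable
  using (Dec; yes; no; map′; _×-dec_; decidable-stable)
open import Relation.Nullary.Negation using (¬_; contradiction)
open import Relation.Unary using (Pred; Decidable)

-- Decidable equality of constraints, which makes membership in a completion set decidable.

cong₂-dec : ∀ {A B C : Set} (f : A → B → C) →
  (∀ {a a′ b b′} → f a b ≡ f a′ b′ → a ≡ a′ × b ≡ b′) →
  ∀ {a a′ b b′} → Dec (a ≡ a′) → Dec (b ≡ b′) → Dec (f a b ≡ f a′ b′)
cong₂-dec f inj a? b? = map′ (λ (p , q) → cong₂ f p q) inj (a? ×-dec b?)

-- Comparing tags first leaves only the diagonal cases of decidable equality.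
tagᶜ : NConcept n → ℕ
tagᶜ (pos _)  = 0
tagᶜ (neg _)  = 1
tagᶜ (_ ⊓ _)  = 2
tagᶜ (_ ⊔ _)  = 3
tagᶜ (∃ⁿ _ _) = 4
tagᶜ (∀ⁿ _ _) = 5
tagᶜ (□ _ _)  = 6
tagᶜ (◇ _ _)  = 7

mutual
  infix 4 _≟ᶜ_

  _≟ᶜ_ : DecidableEquality (NConcept n)
  C ≟ᶜ D with tagᶜ C ≟ tagᶜ D
  ... | yes eq = sameTagᶜ C D eq
  ... | no ¬eq = no (¬eq ∘ cong tagᶜ)

  sameTagᶜ : (C D : NConcept n) → tagᶜ C ≡ tagᶜ D → Dec (C ≡ D)
  sameTagᶜ (pos A)  (pos B)    _ = map′ (cong pos) (λ { refl → refl }) (A ≟ B)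
  sameTagᶜ (neg A)  (neg B)    _ = map′ (cong neg) (λ { refl → refl }) (A ≟ B)
  sameTagᶜ (C ⊓ D)  (C′ ⊓ D′)  _ = cong₂-dec _⊓_ (λ { refl → refl , refl }) (C ≟ᶜ C′) (D ≟ᶜ D′)
  sameTagᶜ (C ⊔ D)  (C′ ⊔ D′)  _ = cong₂-dec _⊔_ (λ { refl → refl , refl }) (C ≟ᶜ C′) (D ≟ᶜ D′)
  sameTagᶜ (∃ⁿ r C) (∃ⁿ s D)   _ = cong₂-dec ∃ⁿ (λ { refl → refl , refl }) (r ≟ s) (C ≟ᶜ D)
  sameTagᶜ (∀ⁿ r C) (∀ⁿ s D)   _ = cong₂-dec ∀ⁿ (λ { refl → refl , refl }) (r ≟ s) (C ≟ᶜ D)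
  sameTagᶜ (□ i C)  (□ j D)    _ = cong₂-dec □ (λ { refl → refl , refl }) (i Fin.≟ j) (C ≟ᶜ D)
  sameTagᶜ (◇ i C)  (◇ j D)    _ = cong₂-dec ◇ (λ { refl → refl , refl }) (i Fin.≟ j) (C ≟ᶜ D)

tagᶠ : NFormula n → ℕ
tagᶠ (⊤⊑ _)  = 0
tagᶠ (¬⊤⊑ _) = 1
tagᶠ (_ ∧ _) = 2
tagᶠ (_ ∨ _) = 3
tagᶠ (□ _ _) = 4
tagᶠ (◇ _ _) = 5

mutual
  infix 4 _≟ᶠ_

  _≟ᶠ_ : DecidableEquality (NFormula n)
  φ ≟ᶠ ψ with tagᶠ φ ≟ tagᶠ ψ
  ... | yes eq = sameTagᶠ φ ψ eq
  ... | no ¬eq = no (¬eq ∘ cong tagᶠ)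

  sameTagᶠ : (φ ψ : NFormula n) → tagᶠ φ ≡ tagᶠ ψ → Dec (φ ≡ ψ)
  sameTagᶠ (⊤⊑ C)  (⊤⊑ D)    _ = map′ (cong ⊤⊑_) (λ { refl → refl }) (C ≟ᶜ D)
  sameTagᶠ (¬⊤⊑ C) (¬⊤⊑ D)   _ = map′ (cong ¬⊤⊑_) (λ { refl → refl }) (C ≟ᶜ D)
  sameTagᶠ (φ ∧ ψ) (φ′ ∧ ψ′) _ = cong₂-dec _∧_ (λ { refl → refl , refl }) (φ ≟ᶠ φ′) (ψ ≟ᶠ ψ′)
  sameTagᶠ (φ ∨ ψ) (φ′ ∨ ψ′) _ = cong₂-dec _∨_ (λ { refl → refl , refl }) (φ ≟ᶠ φ′) (ψ ≟ᶠ ψ′)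
  sameTagᶠ (□ i φ) (□ j ψ)   _ = cong₂-dec □ (λ { refl → refl , refl }) (i Fin.≟ j) (φ ≟ᶠ ψ)
  sameTagᶠ (◇ i φ) (◇ j ψ)   _ = cong₂-dec ◇ (λ { refl → refl , refl }) (i Fin.≟ j) (φ ≟ᶠ ψ)

infix 4 _≟ᴱ_ _≟ᴷ_

_≟ᴱ_ : DecidableEquality (Expr n)
fml φ   ≟ᴱ fml ψ   = map′ (cong fml) (λ { refl → refl }) (φ ≟ᶠ ψ)
fml _   ≟ᴱ _ ⟨ _ ⟩ = no λ ()
_ ⟨ _ ⟩ ≟ᴱ fml _   = no λ ()
C ⟨ x ⟩ ≟ᴱ D ⟨ y ⟩ = cong₂-dec _⟨_⟩ (λ { refl → refl , refl }) (C ≟ᶜ D) (x ≟ y)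

_≟ᴷ_ : DecidableEquality (Constraint n)
ℓ ∶ γ           ≟ᴷ μ ∶ δ           = cong₂-dec _∶_ (λ { refl → refl , refl }) (ℓ ≟ μ) (γ ≟ᴱ δ)
_ ∶ _           ≟ᴷ _ ∶ _ ⟪ _ ∙ _ ⟫ = no λ ()
_ ∶ _ ⟪ _ ∙ _ ⟫ ≟ᴷ _ ∶ _           = no λ ()
ℓ ∶ r ⟪ x ∙ y ⟫ ≟ᴷ μ ∶ s ⟪ z ∙ w ⟫ =
  map′ (λ { ((refl , refl) , refl , refl) → refl }) (λ { refl → (refl , refl) , refl , refl })
    ((ℓ ≟ μ ×-dec r ≟ s) ×-dec (x ≟ z ×-dec y ≟ w))

-- Involutivity of NNF negation.

¬̇ᶜ-involutive : (C : NConcept n) → ¬̇ᶜ (¬̇ᶜ C) ≡ C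
¬̇ᶜ-involutive (pos A)  = refl
¬̇ᶜ-involutive (neg A)  = refl
¬̇ᶜ-involutive (C ⊓ D)  = cong₂ _⊓_ (¬̇ᶜ-involutive C) (¬̇ᶜ-involutive D)
¬̇ᶜ-involutive (C ⊔ D)  = cong₂ _⊔_ (¬̇ᶜ-involutive C) (¬̇ᶜ-involutive D)
¬̇ᶜ-involutive (∃ⁿ r C) = cong (∃ⁿ r) (¬̇ᶜ-involutive C)
¬̇ᶜ-involutive (∀ⁿ r C) = cong (∀ⁿ r) (¬̇ᶜ-involutive C)
¬̇ᶜ-involutive (□ i C)  = cong (□ i) (¬̇ᶜ-involutive C)
¬̇ᶜ-involutive (◇ i C)  = cong (◇ i) (¬̇ᶜ-involutive C)

¬̇ᶠ-involutive : (φ : NFormula n) → ¬̇ᶠ (¬̇ᶠ φ) ≡ φ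
¬̇ᶠ-involutive (⊤⊑ C)  = refl
¬̇ᶠ-involutive (¬⊤⊑ C) = refl
¬̇ᶠ-involutive (φ ∧ ψ) = cong₂ _∧_ (¬̇ᶠ-involutive φ) (¬̇ᶠ-involutive ψ)
¬̇ᶠ-involutive (φ ∨ ψ) = cong₂ _∨_ (¬̇ᶠ-involutive φ) (¬̇ᶠ-involutive ψ)
¬̇ᶠ-involutive (□ i φ) = cong (□ i) (¬̇ᶠ-involutive φ)
¬̇ᶠ-involutive (◇ i φ) = cong (◇ i) (¬̇ᶠ-involutive φ)

¬̇ᴱ-involutive : (γ : Expr n) → ¬̇ᴱ (¬̇ᴱ γ) ≡ γ
¬̇ᴱ-involutive (fml φ)   = cong fml (¬̇ᶠ-involutive φ)
¬̇ᴱ-involutive (C ⟨ x ⟩) = cong (_⟨ x ⟩) (¬̇ᶜ-involutive C)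

-- Fresh variables and labels.

strictBound : List ℕ → ℕ
strictBound = foldr (λ m b → suc m ⊔ℕ b) 0

∈⇒<strictBound : ∀ {m ms} → m ∈ ms → m < strictBound ms
∈⇒<strictBound {m} {_ ∷ ms} (here refl) = m≤m⊔n (suc m) (strictBound ms)
∈⇒<strictBound (there {x = k} m∈) = <-≤-trans (∈⇒<strictBound m∈) (m≤n⊔m (suc k) _)

strictBound-least : ∀ {b} ms → (∀ {m} → m ∈ ms → m < b) → strictBound ms ≤ b
strictBound-least []       _     = z≤n
strictBound-least (_ ∷ ms) below = ⊔-lub (below (here refl)) (strictBound-least ms (below ∘ there))

-- A fresh variable exceeds every occurring one, so the least strict upper bound of the occurring
-- variables is minimal among the fresh ones; irreflexivity of `<` shows that it does not occur
-- itself.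
minFreshVar : (S : Constraints n) → ∃ λ x → MinFreshVar x S
minFreshVar S = strictBound (vars S)
  , ((<-irrefl refl ∘ ∈⇒<strictBound) , ∈⇒<strictBound)
  , strictBound-least (vars S) ∘ proj₂

freshLabel : (T : Constraints n) → ∃ λ μ → FreshLabel μ T
freshLabel T = strictBound (map label T)
  , λ c∈ eq → <-irrefl eq (∈⇒<strictBound (∈-map⁺ label c∈))

∃? : ∀ {P : Pred ℕ 0ℓ} → Decidable P → (xs : List ℕ) → (∀ {x} → P x → x ∈ xs) → Dec (∃ P)
∃? P? xs P⊆xs = map′ satisfied (λ (_ , p) → lose (P⊆xs p) p) (any? P? xs)

-- Every logic admits the modal rule with one box, so a single box constraint can generate a
-- neighbourhood without a case split on `L`.
params₁ : ∀ L → ∃ (Params L 1)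
params₁ 𝐄 = 1 , E₁₁
params₁ 𝐌 = 0 , M₁₀
params₁ 𝐂 = 1 , Cₖₖ
params₁ 𝐍 = 1 , N₁₁

Constructs⇒initial⊆ : ∀ {L} {S T : Constraints n} → Star (Step L) S T → ∀ {c} → c ∈ S → c ∈ T
Constructs⇒initial⊆ ε = λ c∈ → c∈
Constructs⇒initial⊆ (step {concl = concl} _ _ _ ◅ steps) =
  Constructs⇒initial⊆ steps ∘ ∈-++⁺ʳ concl ∘ ∈-++⁺ʳ (topsFor concl)

-- Closure of a complete, clash-free set under the rules.

module CanonicalModel {n} {L : Logic} {T : Constraints n}
  (complete : Complete L T) (clashFree : ClashFree T) where

  open DecMembership (_≟ᴷ_ {n}) using (_∈?_)
  open DecMembership _≟_ using () renaming (_∈?_ to _∈ᵛ?_)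

  occurs : ∀ {c x} → c ∈ T → x ∈ varsOf c → x ∈ vars (𝑆 (label c) T)
  occurs c∈ x∈ = ∈-concatMap⁺ varsOf (lose (∈-filter⁺ (λ c → label c ≟ _) c∈ refl) x∈)

  ¬̇¬̇-closed : ∀ {ℓ} γ → (ℓ ∶ ¬̇ᴱ (¬̇ᴱ γ)) ∈ T → (ℓ ∶ γ) ∈ T
  ¬̇¬̇-closed {ℓ} γ = subst (λ δ → (ℓ ∶ δ) ∈ T) (¬̇ᴱ-involutive γ)

  -- Completeness only refutes the absence of the conclusions; decidable membership turns this into
  -- presence.
  ∧-closed : ∀ {ℓ ψ χ} → (ℓ ∶ fml (ψ ∧ χ)) ∈ T → (ℓ ∶ fml ψ) ∈ T × (ℓ ∶ fml χ) ∈ T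
  ∧-closed ∈T = decidable-stable (_ ∈? T ×-dec _ ∈? T) (complete _ ∘ R-∧ ∈T)

  -- The negative form fits the encoding of `_∨ᶠ_` as a negated conjunction of negations.
  ∨-closed : ∀ {ℓ ψ χ} → (ℓ ∶ fml (ψ ∨ χ)) ∈ T → ¬ ((ℓ ∶ fml ψ) ∉ T × (ℓ ∶ fml χ) ∉ T)
  ∨-closed ∈T (ψ∉ , χ∉) = complete _ (R-∨ ∈T ψ∉ χ∉)

  ⊓-closed : ∀ {ℓ C D x} → (ℓ ∶ (C ⊓ D) ⟨ x ⟩) ∈ T → (ℓ ∶ C ⟨ x ⟩) ∈ T × (ℓ ∶ D ⟨ x ⟩) ∈ T
  ⊓-closed ∈T = decidable-stable (_ ∈? T ×-dec _ ∈? T) (complete _ ∘ R-⊓ ∈T)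

  ⊔-closed : ∀ {ℓ C D x} → (ℓ ∶ (C ⊔ D) ⟨ x ⟩) ∈ T → ¬ ((ℓ ∶ C ⟨ x ⟩) ∉ T × (ℓ ∶ D ⟨ x ⟩) ∉ T)
  ⊔-closed ∈T (C∉ , D∉) = complete _ (R-⊔ ∈T C∉ D∉)

  ⊤⊑-closed : ∀ {ℓ C x} → (ℓ ∶ fml (⊤⊑ C)) ∈ T → x ∈ vars (𝑆 ℓ T) → (ℓ ∶ C ⟨ x ⟩) ∈ T
  ⊤⊑-closed ∈T x∈ = decidable-stable (_ ∈? T) (complete _ ∘ R-= ∈T x∈)

  -- A doubly negated witness is enough, since a negated inclusion is itself a negation to be
  -- proved.
  ¬⊤⊑-closed : ∀ {ℓ C} → (ℓ ∶ fml (¬⊤⊑ C)) ∈ T → ¬ (∀ y → (ℓ ∶ ¬̇ᶜ C ⟨ y ⟩) ∉ T)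
  ¬⊤⊑-closed {ℓ} ∈T = complete _ ∘ R-≠ ∈T (proj₂ (minFreshVar (𝑆 ℓ T)))

  -- Role edges and blocking.

  Edge : Label → RoleName → Var → Var → Set
  Edge ℓ r x y = ∃ λ z → (z ≡ x ⊎ BlockedBy ℓ T x z) × (ℓ ∶ r ⟪ z ∙ y ⟫) ∈ T

  Edge⇒∈vars : ∀ {ℓ r x y} → Edge ℓ r x y → x ∈ vars (𝑆 ℓ T) × y ∈ vars (𝑆 ℓ T)
  Edge⇒∈vars (_ , inj₁ refl , r∈)   = occurs r∈ (here refl) , occurs r∈ (there (here refl))
  Edge⇒∈vars (_ , inj₂ blocked , r∈) = proj₁ blocked , occurs r∈ (there (here refl))

  -- A blocker carries every concept of the variable that it blocks, so `R-∀` acts at the blocker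
  -- along the inherited edge.
  ∀-closed : ∀ {ℓ r C x y} → (ℓ ∶ ∀ⁿ r C ⟨ x ⟩) ∈ T → Edge ℓ r x y → (ℓ ∶ C ⟨ y ⟩) ∈ T
  ∀-closed ∈T (_ , inj₁ refl , r∈) =
    decidable-stable (_ ∈? T) (complete _ ∘ R-∀ ∈T r∈)
  ∀-closed ∈T (_ , inj₂ (_ , _ , _ , x⊆z) , r∈) =
    decidable-stable (_ ∈? T) (complete _ ∘ R-∀ (x⊆z ∈T) r∈)

  -- Collapses a chain of blockers, so that an edge found at its end is inherited directly by its
  -- first variable.
  BlockedBy-trans : ∀ {ℓ x y z} → BlockedBy ℓ T x y → BlockedBy ℓ T y z → BlockedBy ℓ T x z
  BlockedBy-trans (x∈ , _ , y<x , x⊆y) (_ , z∈ , z<y , y⊆z) =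
    x∈ , z∈ , <-trans z<y y<x , y⊆z ∘ x⊆y

  -- The quantifier over all concepts is decided by running through the finitely many constraints of
  -- `T`.
  ⊆labels? : ∀ ℓ x y → Dec (∀ {C} → (ℓ ∶ C ⟨ x ⟩) ∈ T → (ℓ ∶ C ⟨ y ⟩) ∈ T)
  ⊆labels? ℓ x y = map′ (λ all ∈T → All.lookup all ∈T refl) (λ x⊆y → All.tabulate λ { ∈T refl → x⊆y ∈T })
      (all? inherited? T)
    where
    inherited? : ∀ c → Dec (∀ {C} → c ≡ (ℓ ∶ C ⟨ x ⟩) → (ℓ ∶ C ⟨ y ⟩) ∈ T)
    inherited? (_ ∶ fml _)         = yes λ ()
    inherited? (_ ∶ _ ⟪ _ ∙ _ ⟫) = yes λ ()
    inherited? c@(_ ∶ C ⟨ _ ⟩) with c ≟ᴷ (ℓ ∶ C ⟨ x ⟩)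
    ... | no ¬eq   = yes λ { refl → contradiction refl ¬eq }
    ... | yes refl = map′ (λ { ∈T refl → ∈T }) (λ f → f refl) ((ℓ ∶ C ⟨ y ⟩) ∈? T)

  blockedBy? : ∀ ℓ x y → Dec (BlockedBy ℓ T x y)
  blockedBy? ℓ x y = x ∈ᵛ? _ ×-dec y ∈ᵛ? _ ×-dec y <? x ×-dec ⊆labels? ℓ x y

  -- Recursion along blockers ends in an unblocked variable, which has a proper successor.
  ∃-closed : ∀ {ℓ r C x} → Acc _<_ x → (ℓ ∶ ∃ⁿ r C ⟨ x ⟩) ∈ T →
    ∃ λ y → (ℓ ∶ C ⟨ y ⟩) ∈ T × Edge ℓ r x y
  ∃-closed {ℓ} {r} {C} {x} (acc rec) ∈T
    with ∃? (λ z → (ℓ ∶ r ⟪ x ∙ z ⟫) ∈? T ×-dec (ℓ ∶ C ⟨ z ⟩) ∈? T)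
           (vars (𝑆 ℓ T)) (λ p → occurs (proj₂ p) (here refl))
  ... | yes (y , r∈ , C∈) = y , C∈ , x , inj₁ refl , r∈
  ... | no ¬succ with ∃? (blockedBy? ℓ x) (vars (𝑆 ℓ T)) (proj₁ ∘ proj₂)
  ...   | no ¬blocked =
          ⊥-elim (complete _ (R-∃ ∈T (λ z b → ¬blocked (z , b)) (λ z s → ¬succ (z , s)) (proj₂ (minFreshVar (𝑆 ℓ T)))))
  ...   | yes (z , blocked@(_ , _ , z<x , x⊆z)) with ∃-closed (rec z<x) (x⊆z ∈T)
  ...     | y , C∈ , _ , inj₁ refl , r∈ = y , C∈ , z , inj₂ blocked , r∈
  ...     | y , C∈ , z′ , inj₂ blocked′ , r∈ = y , C∈ , z′ , inj₂ (BlockedBy-trans blocked blocked′) , r∈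

  -- Worlds, neighbourhoods and frame conditions.

  World : Set
  World = ∃ λ ℓ → ℓ ∈ map label T

  world : ∀ {c} → c ∈ T → World
  world {c} c∈ = label c , ∈-map⁺ label c∈

  -- A world is a label together with a proof that it occurs in `T`. If the occurrence is a formula
  -- constraint and the label has no variable, `R-nonempty` is applicable.
  domain-nonempty : (w : World) → ∃ λ x → x ∈ vars (𝑆 (proj₁ w) T)
  domain-nonempty (_ , ℓ∈) with ∈-map⁻ label ℓ∈
  ... | (_ ∶ _ ⟨ _ ⟩)         , c∈ , refl = _ , occurs c∈ (here refl)
  ... | (_ ∶ _ ⟪ _ ∙ _ ⟫) , c∈ , refl = _ , occurs c∈ (here refl)
  ... | (ℓ ∶ fml _)         , c∈ , refl with vars (𝑆 ℓ T) in eq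
  ...   | []    = ⊥-elim (complete _ (R-nonempty c∈ eq (proj₂ (minFreshVar (𝑆 ℓ T)))))
  ...   | _ ∷ _ = _ , here refl

  record Neighbourhood (i : Fin n) (v : World) (α : Pred World 0ℓ) : Set where
    constructor neighbourhood
    field
      {k l}   : ℕ
      params  : Params L k l
      γs      : List (Expr n)
      length≡ : length γs ≡ k
      boxes   : All (λ γ → (proj₁ v ∶ □ᴱ i γ) ∈ T) γs
      lower   : ∀ {u} → All (λ γ → (proj₁ u ∶ γ) ∈ T) γs → α u
      upper   : ∀ {u} → α u → All (λ γ → (proj₁ u ∶ ¬̇ᴱ γ) ∉ T) (take l γs)

  frame : World → Frame n
  frame w = record
    { W        = World
    ; nonempty = w
    ; 𝒩        = Neighbourhood
    ; 𝒩-resp-≐ = λ { _ _ (α⊆β , β⊆α) (neighbourhood p γs len boxes lower upper) →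
        neighbourhood p γs len boxes (α⊆β ∘ lower) (upper ∘ β⊆α) }
    }

  □-neighbourhood : ∀ {i v α} γ → (proj₁ v ∶ □ᴱ i γ) ∈ T →
    (∀ {u : World} → (proj₁ u ∶ γ) ∈ T → α u) →
    (∀ {u} → α u → (proj₁ u ∶ ¬̇ᴱ γ) ∉ T) →
    Neighbourhood i v α
  □-neighbourhood γ ∈T lower upper = neighbourhood (proj₂ (params₁ L)) [ γ ] refl (∈T ∷ [])
    (lower ∘ All.head) (λ αu → All.take⁺ _ (upper αu ∷ []))

  -- The two bounds of a neighbourhood block the two kinds of alternatives of `R-modal`: by `lower`,
  -- a label with all of `γs` and `δ` would be in `α`; by `upper`, a label with some `¬̇ᴱ γ` and
  -- `¬̇ᴱ δ` would be outside it. Hence the rule would be applicable with a fresh label.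
  ◇-¬neighbourhood : ∀ {i v α} δ → (proj₁ v ∶ ◇ᴱ i δ) ∈ T →
    (∀ {u : World} → (proj₁ u ∶ δ) ∈ T → ¬ α u) →
    (∀ {u} → (proj₁ u ∶ ¬̇ᴱ δ) ∈ T → α u) →
    ¬ Neighbourhood i v α
  ◇-¬neighbourhood δ ∈T δ⇒¬α ¬̇δ⇒α (neighbourhood p γs len boxes lower upper) =
    complete _ (R-modal p len boxes ∈T (proj₂ (freshLabel T))
      (λ ν (γs∈ , δ∈) → δ⇒¬α {world δ∈} δ∈ (lower γs∈))
      -- The constraint extracted from `any` certifies that `ν` is a world.
      (λ ν any → let _ , _ , ¬̇δ∈ = satisfied any in
        All¬⇒¬Any (upper {world ¬̇δ∈} (¬̇δ⇒α ¬̇δ∈)) (Any.map proj₁ any)))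

  frameFor : ∀ w → FrameFor L (frame w)
  frameFor w = conditions L refl
    where
    -- The equation allows matching on the logic although `L` is a module parameter.
    conditions : ∀ L′ → L ≡ L′ → FrameFor L′ (frame w)
    conditions 𝐄 refl = lift tt
    -- Since l = 0, no upper bound constrains the larger set.
    conditions 𝐌 refl _ _ α⊆β (neighbourhood M₁₀ γs len boxes lower upper) =
      neighbourhood M₁₀ γs len boxes (α⊆β ∘ lower) (λ _ → [])
    -- The intersection is generated by the concatenated premises. Since l = k is the number of
    -- premises, `take` keeps them all, and the upper bounds concatenate as well.
    conditions 𝐂 refl _ _
      (neighbourhood Cₖₖ γs len boxes lower upper)
      (neighbourhood Cₖₖ γs′ len′ boxes′ lower′ upper′) =
        neighbourhood Cₖₖ (γs ++ γs′) len″ (All.++⁺ boxes boxes′)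
          (λ all → lower (All.++⁻ˡ γs all) , lower′ (All.++⁻ʳ γs all))
          (λ (αu , βu) → All.take⁺ _ (All.++⁺ (untake len (upper αu)) (untake len′ (upper′ βu))))
      where
      len″ = trans (length-++ γs) (cong₂ _+_ len len′)

      untake : ∀ {m} {P : Pred (Expr n) 0ℓ} {γs : List (Expr n)} → length γs ≡ m → All P (take m γs) → All P γs
      untake {P = P} len = subst (All P) (take-all _ _ (≤-reflexive len))
    -- With k = l = 0 the empty list of premises generates the unit.
    conditions 𝐍 refl = lift λ _ _ → neighbourhood N₀₀ [] refl [] _ (λ _ → [])

  -- The model and the truth lemma.

  model : ∀ w → Model (frame w)
  model w = record
    { Object     = Var
    ; Δ          = λ v x → x ∈ vars (𝑆 (proj₁ v) T)
    ; Δ-nonempty = domain-nonempty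
    ; conceptᴵ   = λ v A x → (proj₁ v ∶ pos A ⟨ x ⟩) ∈ T
    ; conceptᴵ⊆Δ = λ _ _ ∈T → occurs ∈T (here refl)
    ; roleᴵ      = λ v → Edge (proj₁ v)
    ; roleᴵ⊆Δ    = λ _ _ → Edge⇒∈vars
    }

  module _ (w : World) where

    mutual
      trueᶜ : ∀ C {v x} → (proj₁ v ∶ C ⟨ x ⟩) ∈ T → ext (model w) ⌊ C ⌋ᶜ v x
      trueᶜ (pos A)  ∈T = ∈T
      trueᶜ (neg A)  ∈T = occurs ∈T (here refl) , λ pos∈ → clashFree (conceptClash pos∈ ∈T)
      trueᶜ (C ⊓ D)  ∈T = let C∈ , D∈ = ⊓-closed ∈T in trueᶜ C C∈ , trueᶜ D D∈
      trueᶜ (C ⊔ D)  ∈T = occurs ∈T (here refl) , λ ((_ , ¬C) , (_ , ¬D)) →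
        ⊔-closed ∈T ((λ C∈ → ¬C (trueᶜ C C∈)) , (λ D∈ → ¬D (trueᶜ D D∈)))
      trueᶜ (∃ⁿ r C) ∈T = let y , C∈ , edge = ∃-closed (<-wellFounded _) ∈T in
        occurs ∈T (here refl) , y , trueᶜ C C∈ , edge
      trueᶜ (∀ⁿ r C) ∈T = occurs ∈T (here refl) , λ (_ , _ , (_ , ¬C) , edge) →
        ¬C (trueᶜ C (∀-closed ∈T edge))
      trueᶜ (□ i C)  ∈T = occurs ∈T (here refl) ,
        □-neighbourhood (C ⟨ _ ⟩) ∈T (trueᶜ C) (λ c ¬C∈ → falseᶜ C ¬C∈ c)
      trueᶜ (◇ i C)  ∈T = occurs ∈T (here refl) , λ (_ , nbhd) →
        ◇-¬neighbourhood (C ⟨ _ ⟩) ∈T (λ C∈ (_ , ¬C) → ¬C (trueᶜ C C∈))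
          (λ ¬C∈ → occurs ¬C∈ (here refl) , falseᶜ C ¬C∈) nbhd

      -- The induction is on `C` rather than on `¬̇ᶜ C`, so that the calls between `trueᶜ` and
      -- `falseᶜ` always pass to subconcepts.
      falseᶜ : ∀ C {v x} → (proj₁ v ∶ ¬̇ᶜ C ⟨ x ⟩) ∈ T → ¬ ext (model w) ⌊ C ⌋ᶜ v x
      falseᶜ (pos A)  ∈T pos∈ = clashFree (conceptClash pos∈ ∈T)
      falseᶜ (neg A)  ∈T (_ , ¬pos∈) = ¬pos∈ ∈T
      falseᶜ (C ⊓ D)  ∈T (c , d) = ⊔-closed ∈T ((λ C∈ → falseᶜ C C∈ c) , (λ D∈ → falseᶜ D D∈ d))
      falseᶜ (C ⊔ D)  ∈T (x∈ , ¬CD) = let C∈ , D∈ = ⊓-closed ∈T in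
        ¬CD ((x∈ , falseᶜ C C∈) , (x∈ , falseᶜ D D∈))
      falseᶜ (∃ⁿ r C) ∈T (_ , _ , c , edge) = falseᶜ C (∀-closed ∈T edge) c
      falseᶜ (∀ⁿ r C) ∈T (x∈ , ¬∃) = let y , C∈ , edge = ∃-closed (<-wellFounded _) ∈T in
        ¬∃ (x∈ , y , (proj₂ (Edge⇒∈vars edge) , falseᶜ C C∈) , edge)
      -- The constraint is a diamond of `¬̇ᶜ C`, so its dual alternative produces `¬̇ᶜ (¬̇ᶜ C)`,
      -- which involutivity reduces to `C`.
      falseᶜ (□ i C)  ∈T (_ , nbhd) = ◇-¬neighbourhood (¬̇ᴱ (C ⟨ _ ⟩)) ∈T (falseᶜ C)
        (λ C∈ → trueᶜ C (¬̇¬̇-closed (C ⟨ _ ⟩) C∈)) nbhd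
      falseᶜ (◇ i C)  ∈T (x∈ , ¬nbhd) = ¬nbhd (x∈ ,
        □-neighbourhood (¬̇ᴱ (C ⟨ _ ⟩)) ∈T (λ ¬C∈ → occurs ¬C∈ (here refl) , falseᶜ C ¬C∈)
          (λ (_ , ¬C) C∈ → ¬C (trueᶜ C (¬̇¬̇-closed (C ⟨ _ ⟩) C∈))))

    ext-⊤ : ∀ {v x} → x ∈ vars (𝑆 (proj₁ v) T) → ext (model w) ⊤ᶜ v x
    ext-⊤ x∈ = x∈ , λ (a , _ , ¬a) → ¬a a

    mutual
      trueᶠ : ∀ φ {v} → (proj₁ v ∶ fml φ) ∈ T → _⊨_ (model w) v ⌊ φ ⌋
      trueᶠ (⊤⊑ C)  ∈T x ⊤x = trueᶜ C (⊤⊑-closed ∈T (proj₁ ⊤x))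
      trueᶠ (¬⊤⊑ C) {v} ∈T sub = ¬⊤⊑-closed ∈T λ y ¬C∈ →
        falseᶜ C ¬C∈ (sub y (ext-⊤ {v} (occurs ¬C∈ (here refl))))
      trueᶠ (φ ∧ ψ) ∈T = let φ∈ , ψ∈ = ∧-closed ∈T in trueᶠ φ φ∈ , trueᶠ ψ ψ∈
      trueᶠ (φ ∨ ψ) ∈T (¬φ , ¬ψ) = ∨-closed ∈T ((λ φ∈ → ¬φ (trueᶠ φ φ∈)) , (λ ψ∈ → ¬ψ (trueᶠ ψ ψ∈)))
      trueᶠ (□ i φ) ∈T = □-neighbourhood (fml φ) ∈T (trueᶠ φ) (λ p ¬φ∈ → falseᶠ φ ¬φ∈ p)
      trueᶠ (◇ i φ) ∈T = ◇-¬neighbourhood (fml φ) ∈T (λ φ∈ ¬φ → ¬φ (trueᶠ φ φ∈)) (falseᶠ φ)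

      falseᶠ : ∀ φ {v} → (proj₁ v ∶ fml (¬̇ᶠ φ)) ∈ T → ¬ _⊨_ (model w) v ⌊ φ ⌋
      falseᶠ (⊤⊑ C)  ∈T = trueᶠ (¬⊤⊑ C) ∈T
      falseᶠ (¬⊤⊑ C) ∈T ¬sub = ¬sub (trueᶠ (⊤⊑ C) ∈T)
      falseᶠ (φ ∧ ψ) ∈T (p , q) = ∨-closed ∈T ((λ φ∈ → falseᶠ φ φ∈ p) , (λ ψ∈ → falseᶠ ψ ψ∈ q))
      falseᶠ (φ ∨ ψ) ∈T ¬φψ = let φ∈ , ψ∈ = ∧-closed ∈T in ¬φψ (falseᶠ φ φ∈ , falseᶠ ψ ψ∈)
      falseᶠ (□ i φ) ∈T = ◇-¬neighbourhood (¬̇ᴱ (fml φ)) ∈T (falseᶠ φ)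
        (λ φ∈ → trueᶠ φ (¬̇¬̇-closed (fml φ) φ∈))
      falseᶠ (◇ i φ) ∈T ¬nbhd = ¬nbhd (□-neighbourhood (¬̇ᴱ (fml φ)) ∈T (falseᶠ φ)
        (λ ¬φ φ∈ → ¬φ (trueᶠ φ (¬̇¬̇-closed (fml φ) φ∈))))

theorem2 : ∀ (n : ℕ) → n ≥ 1 → (L : Logic) (φ : NFormula n) (x : Var) (T : Constraints n) →
    Constructs L φ x T → CompletionSetFor φ T → Complete L T → ClashFree T →
    Satisfiable L ⌊ φ ⌋
theorem2 n _ L φ x T constructs _ complete clashFree =
  frame w , frameFor w , model w , w , trueᶠ w φ φ∈T
  where
  open CanonicalModel complete clashFree
  -- Steps only add constraints, so label 0 still carries `φ` and is the world that satisfies it.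
  φ∈T = Constructs⇒initial⊆ constructs (here refl)
  w   = world φ∈T
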